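{- Let $\kappa$ be an uncountable regular cardinal. The following are equivalent: (1) $\diamondsuit_\kappa$ holds; (2) there is a joint diamond sequence of length $\kappa$ for $\kappa$; (3) there is a joint diamond sequence of length $2^\kappa$ for $\kappa$; (4) there exists a $\diamondsuit_\kappa$-tree.
   Context: A filter on $\kappa$ is normal if it is closed under diagonal intersections of $\kappa$-sequences of its members, and uniform if it contains all cobounded subsets of $\kappa$. A $\kappa$-list is a function $d\colon\kappa\to\mathcal{P}(\kappa)$ with $d(\alpha)\subseteq\alpha$ for all $\alpha$. A joint diamond sequence of length $\lambda$ for $\kappa$ is a sequence $\langle d_\alpha;\alpha<\lambda\rangle$ of $\kappa$-lists such that for every sequence $\langle a_\alpha;\alpha<\lambda\rangle$ of subsets of $\kappa$ there is a proper normal uniform filter $\mathcal{F}$ on $\kappa$ with $\{\xi<\kappa : d_\alpha(\xi)=a_\alpha\cap\xi\}\in\mathcal{F}$ for every $\alpha<\lambda$. A $\diamondsuit_\kappa$-tree is a function $D\colon {}^{<\kappa}2\to\mathcal{P}(\kappa)$ such that for every sequence $\langle a_s; s\in{}^\kappa 2\rangle$ of subsets of $\kappa$ there is a proper normal uniform filter on $\kappa$ containing all the sets $S_s=\{\xi<\kappa : D(s\restriction\xi)=a_s\cap\xi\}$, $s\in{}^\kappa2$. -}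

module Defs where

open import Data.Bool using (Bool)
open import Data.Nat using (ℕ)
open import Data.Product using (Σ; ∃; _×_; _,_; proj₁)
open import Function using (_∘_)
open import Function.Bundles using (_↣_; _⤖_)
open import Level using (0ℓ)
open import Relation.Binary.Core using (Rel)
open import Relation.Binary.Definitions using (Irrelevant)
open import Relation.Binary.PropositionalEquality using (_≡_)
open import Relation.Binary.Structures using (IsStrictTotalOrder)
open import Relation.Nullary using (¬_)
open import Relation.Unary
  using (Pred; _∈_; _∉_; _⊆_; _≐_; _∩_; ∁; ∅; U; Satisfiable)
open import Induction.WellFounded using (WellFounded)

-- Ordinals are taken up to isomorphism, as well-ordered types.  The order is
-- proof-irrelevant so that the initial segment ↓ α below has exactly one
-- element for each β < α.
record Ordinal : Set₁ where
  field
    Carrier            : Set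
    _<_                : Rel Carrier 0ℓ
    isStrictTotalOrder : IsStrictTotalOrder _≡_ _<_
    <-wellFounded      : WellFounded _<_
    <-irrelevant       : Irrelevant _<_

  -- The element ξ of κ, seen as a subset of κ (von Neumann) ...
  segment : Carrier → Pred Carrier 0ℓ
  segment ξ α = α < ξ

  -- ... and as a type in its own right.
  ↓_ : Carrier → Set
  ↓ ξ = Σ Carrier (_< ξ)

module _ (κ : Ordinal) where
  open Ordinal κ

  IsCardinal : Set
  IsCardinal = ∀ α → ¬ (Carrier ⤖ (↓ α))

  Uncountable : Set
  Uncountable = ¬ (Carrier ↣ ℕ)

  -- ¬ (f i < β) says β ≤ f i, the order being total.
  Cofinal : {I : Set} → (I → Carrier) → Set
  Cofinal f = ∀ β → ∃ λ i → ¬ (f i < β)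

  -- cf κ = κ, for infinite κ.
  Regular : Set
  Regular = ∀ α (f : ↓ α → Carrier) → ¬ Cofinal f

  record UncountableRegularCardinal : Set where
    field
      isCardinal  : IsCardinal
      uncountable : Uncountable
      regular     : Regular

  Subset : Set₁
  Subset = Pred Carrier 0ℓ

  Bounded : Subset → Set
  Bounded X = ∃ λ γ → X ⊆ segment γ

  Cobounded : Subset → Set
  Cobounded X = Bounded (∁ X)

  Unbounded : Subset → Set
  Unbounded C = ∀ β → ∃ λ γ → γ ∈ C × β < γ

  -- ξ is a limit ordinal and C ∩ ξ is unbounded in ξ.
  LimitPoint : Subset → Carrier → Set
  LimitPoint C ξ =
    (∃ λ β → β < ξ) × (∀ β → β < ξ → ∃ λ γ → γ ∈ C × β < γ × γ < ξ)

  Closed : Subset → Set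
  Closed C = ∀ ξ → LimitPoint C ξ → ξ ∈ C

  Club : Subset → Set
  Club C = Closed C × Unbounded C

  Stationary : Subset → Set₁
  Stationary S = ∀ C → Club C → Satisfiable (S ∩ C)

  Δ : (Carrier → Subset) → Subset
  Δ X ξ = ∀ α → α < ξ → ξ ∈ X α

  -- Closure under ⊆ makes membership independent of how a subset is presented.
  record IsFilter (F : Pred Subset 0ℓ) : Set₁ where
    field
      U-mem    : U ∈ F
      ∩-closed : ∀ {X Y} → X ∈ F → Y ∈ F → (X ∩ Y) ∈ F
      ⊆-closed : ∀ {X Y} → X ∈ F → X ⊆ Y → Y ∈ F

  record IsProperNormalUniformFilter (F : Pred Subset 0ℓ) : Set₁ where
    field
      isFilter : IsFilter F
      proper   : ∅ ∉ F
      normal   : ∀ X → (∀ α → X α ∈ F) → Δ X ∈ F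
      uniform  : ∀ X → Cobounded X → X ∈ F

  record κ-List : Set₁ where
    field
      _at_    : Carrier → Subset
      bounded : ∀ α → _at_ α ⊆ segment α

  open κ-List

  guesses : κ-List → Subset → Subset
  guesses d a ξ = (d at ξ) ≐ (a ∩ segment ξ)

  ◇ : Set₁
  ◇ = ∃ λ (d : κ-List) → ∀ (a : Subset) → Stationary (guesses d a)

  -- The length is given by an arbitrary index type Λ, since an ordering of
  -- the length plays no role.
  IsJointDiamondSequence : (Λ : Set) → (Λ → κ-List) → Set₁
  IsJointDiamondSequence Λ d =
    ∀ (a : Λ → Subset) →
    ∃ λ (F : Pred Subset 0ℓ) →
      IsProperNormalUniformFilter F × (∀ α → guesses (d α) (a α) ∈ F)

  JointDiamond : Set → Set₁
  JointDiamond Λ = ∃ λ (d : Λ → κ-List) → IsJointDiamondSequence Λ d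

  -- ^κ 2
  Branch : Set
  Branch = Carrier → Bool

  -- ^{<κ} 2
  Node : Set
  Node = Σ Carrier λ ξ → ↓ ξ → Bool

  _↾_ : Branch → Carrier → Node
  s ↾ ξ = ξ , s ∘ proj₁

  IsDiamondTree : (Node → Subset) → Set₁
  IsDiamondTree D =
    ∀ (a : Branch → Subset) →
    ∃ λ (F : Pred Subset 0ℓ) →
      IsProperNormalUniformFilter F
      × (∀ s → (λ ξ → D (s ↾ ξ) ≐ (a s ∩ segment ξ)) ∈ F)

  DiamondTree : Set₁
  DiamondTree = ∃ λ (D : Node → Subset) → IsDiamondTree D

{-# OPTIONS --safe #-}
-- The crux is that ◇ yields a ◇-tree.  Through a pairing function, ◇ guesses at
-- ξ a whole family of pairs (s α ↾ ξ , a (s α) ∩ ξ), α < ξ; let D send a node t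
-- at level ξ to the second component of the pairs whose first component is t.
-- This is unambiguous for club many ξ, namely those below which any two
-- distinct s α, s β with α, β < ξ already differ.  So for every s : κ → ^κ 2 the
-- diagonal intersection of the sets S_(s α) is stationary, and hence the normal
-- filter generated by all S_s is proper.  The branches of a ◇-tree form a joint
-- diamond sequence of length 2^κ, which restricts to length κ and to length 1,
-- and length 1 gives ◇ back because normal uniform filters contain all clubs.
module Submission where

open import Defs
open import Axiom.ExcludedMiddle using (ExcludedMiddle)
open import Axiom.Extensionality.Propositional using (Extensionality)
open import Data.Bool using (Bool; true; false; if_then_else_)
open import Data.Empty using (⊥-elim)
open import Data.Nat using (ℕ; zero; suc; _<′_; <′-base; <′-step)
open import Data.Nat.Properties using (<-cmp; <⇒<′)
open import Data.Product using (∃; _×_; _,_; proj₁; proj₂; uncurry)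
open import Data.Product.Relation.Binary.Lex.Strict
  using (×-Lex; ×-wellFounded; ×-compare)
open import Data.Sum using (_⊎_; inj₁; inj₂)
open import Data.Unit using (⊤; tt)
open import Function using (_∘_; _on_; const)
open import Function.Bundles
  using (_⇔_; _⤖_; mk⇔; mk↣; module Equivalence; module Inverse)
open import Function.Properties.Bijection using (⤖⇒↔)
open import Induction.WellFounded using (Acc; acc; WellFounded; module All; module FixPoint)
open import Level using (0ℓ)
open import Relation.Binary.Construct.On as On using ()
open import Relation.Binary.Core using (Rel)
open import Relation.Binary.Definitions using (tri<; tri≈; tri>)
open import Relation.Binary.PropositionalEquality
  using (_≡_; _≢_; refl; sym; trans; cong; cong₂; subst; subst₂)
open import Relation.Binary.Structures using (IsStrictTotalOrder)
open import Relation.Nullary using (¬_; Dec; yes; no; does)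
open import Relation.Nullary.Decidable using (decidable-stable; dec-true; dec-false)
open import Relation.Unary using (Pred; _∈_; _≐_; _∩_; Satisfiable)

-- Classical choices and left inverses of injections.

module Classical (em : ExcludedMiddle 0ℓ) where

  dne : {P : Set} → ¬ ¬ P → P
  dne = decidable-stable em

  counterexample : {A : Set} {P : A → Set} → ¬ (∀ x → P x) → ∃ λ x → ¬ P x
  counterexample ¬∀ = dne λ ¬∃ → ¬∀ λ x → dne λ ¬p → ¬∃ (x , ¬p)

  retraction : {A B : Set} (i : A → B) → (∀ {x y} → i x ≡ i y → x ≡ y) → A →
               ∃ λ (r : B → A) → ∀ x → r (i x) ≡ x
  retraction {A} {B} i i-injective a₀ = (λ y → pick y em) , λ x → pick-inverse x em
    where
    pick : ∀ y → Dec (∃ λ x → i x ≡ y) → A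
    pick y (yes (x , _)) = x
    pick y (no _)        = a₀

    pick-inverse : ∀ x (d : Dec (∃ λ x′ → i x′ ≡ i x)) → pick (i x) d ≡ x
    pick-inverse x (yes (_ , eq)) = i-injective eq
    pick-inverse x (no none)      = ⊥-elim (none (x , refl))

-- Least elements and binary maxima in a well-order.

module WellOrder (em : ExcludedMiddle 0ℓ) (κ : Ordinal) where
  open Ordinal κ
  open IsStrictTotalOrder isStrictTotalOrder public
    using (compare; irrefl; asym) renaming (trans to <-trans)

  least : {P : Carrier → Set} → ∃ P → ∃ λ x → P x × (∀ y → y < x → ¬ P y)
  least {P} (x , px) = descend x (<-wellFounded x) px
    where
    descend : ∀ x → Acc _<_ x → P x → ∃ λ x → P x × (∀ y → y < x → ¬ P y)
    descend x (acc smaller) px with em {∃ λ y → y < x × P y}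
    ... | yes (y , y<x , py) = descend y (smaller y<x) py
    ... | no none            = x , px , λ y y<x py → none (y , y<x , py)

  infixl 21 _⊔_
  _⊔_ : Carrier → Carrier → Carrier
  α ⊔ β with compare α β
  ... | tri< _ _ _ = β
  ... | tri≈ _ _ _ = β
  ... | tri> _ _ _ = α

  ⊔-lub-< : ∀ {α β γ} → α < γ → β < γ → α ⊔ β < γ
  ⊔-lub-< {α} {β} α<γ β<γ with compare α β
  ... | tri< _ _ _ = β<γ
  ... | tri≈ _ _ _ = β<γ
  ... | tri> _ _ _ = α<γ

  ⊔<⇒<ˡ : ∀ {α β γ} → α ⊔ β < γ → α < γ
  ⊔<⇒<ˡ {α} {β} lt with compare α β
  ... | tri< α<β _ _  = <-trans α<β lt
  ... | tri≈ _ refl _ = lt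
  ... | tri> _ _ _    = lt

  ⊔<⇒<ʳ : ∀ {α β γ} → α ⊔ β < γ → β < γ
  ⊔<⇒<ʳ {α} {β} lt with compare α β
  ... | tri< _ _ _    = lt
  ... | tri≈ _ _ _    = lt
  ... | tri> _ _ β<α  = <-trans β<α lt

-- Successors and strict bounds below a regular cardinal.

module RegularCardinal
  (em : ExcludedMiddle 0ℓ) (ext : Extensionality 0ℓ 0ℓ)
  (κ : Ordinal) (urc : UncountableRegularCardinal κ) where

  open Ordinal κ
  open UncountableRegularCardinal urc
  open Classical em
  open WellOrder em κ

  inhabitant : Carrier
  inhabitant = dne λ empty → uncountable
    (mk↣ {to = λ _ → 0} λ {x} _ → ⊥-elim (empty x))

  -- If α were the maximum and had some γ below it, the constant function α on `↓ α` would be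
  -- cofinal, against regularity. With nothing below it, α would be the only element, against
  -- uncountability.
  no-maximum : ∀ α → ∃ λ β → α < β
  no-maximum α = dne λ max → go (λ β α<β → max (β , α<β)) em
    where
    go : (∀ β → ¬ α < β) → ¬ Dec (∃ λ γ → γ < α)
    go max (yes (γ , γ<α)) = regular α (const α) λ β → (γ , γ<α) , max β
    go max (no min)        = uncountable
      (mk↣ {to = λ _ → 0} λ {x} {y} _ → trans (only x) (sym (only y)))
      where
      only : ∀ x → x ≡ α
      only x with compare x α
      ... | tri< x<α _ _  = ⊥-elim (min (x , x<α))
      ... | tri≈ _ x≡α _  = x≡α
      ... | tri> _ _ α<x  = ⊥-elim (max x α<x)

  next : Carrier → Carrier
  next α = proj₁ (least (no-maximum α))

  <next : ∀ α → α < next α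
  <next α = proj₁ (proj₂ (least (no-maximum α)))

  <⇒≮next : ∀ {α β} → α < β → ¬ β < next α
  <⇒≮next {α} {β} α<β β<next = proj₂ (proj₂ (least (no-maximum α))) β β<next α<β

  ≮⇒<next : ∀ {α β} → ¬ β < α → α < next β
  ≮⇒<next {α} {β} β≮α with compare α β
  ... | tri< α<β _ _  = <-trans α<β (<next β)
  ... | tri≈ _ refl _ = <next β
  ... | tri> _ _ β<α  = ⊥-elim (β≮α β<α)

  strict-bound : ∀ γ (f : ↓ γ → Carrier) → ∃ λ β → ∀ i → f i < β
  strict-bound γ f with counterexample (regular γ f)
  ... | β , ¬∃ = β , λ i → dne λ fi≮β → ¬∃ (i , fi≮β)

  strict-bound₂ : ∀ γ (f : Carrier → Carrier → Carrier) →
                  ∃ λ δ → ∀ α β → α < γ → β < γ → f α β < δ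
  strict-bound₂ γ f = proj₁ outer , λ α β α<γ β<γ →
    <-trans (proj₂ (inner α) (β , β<γ)) (proj₂ outer (α , α<γ))
    where
    inner : ∀ α → ∃ λ δ → ∀ i → f α (proj₁ i) < δ
    inner α = strict-bound γ (f α ∘ proj₁)

    outer : ∃ λ δ → ∀ i → proj₁ (inner (proj₁ i)) < δ
    outer = strict-bound γ (proj₁ ∘ inner ∘ proj₁)

  -- Finite ordinals and uncountable cofinality.

  finite : ℕ → Carrier
  finite zero    = proj₁ (least {P = λ _ → ⊤} (inhabitant , tt))
  finite (suc n) = next (finite n)

  finite-mono : ∀ {m n} → m <′ n → finite m < finite n
  finite-mono <′-base       = <next _
  finite-mono (<′-step m<n) = <-trans (finite-mono m<n) (<next _)

  finite-injective : ∀ {m n} → finite m ≡ finite n → m ≡ n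
  finite-injective {m} {n} eq with <-cmp m n
  ... | tri< m<n _ _ = ⊥-elim (irrefl eq (finite-mono (<⇒<′ m<n)))
  ... | tri≈ _ m≡n _ = m≡n
  ... | tri> _ _ n<m = ⊥-elim (irrefl (sym eq) (finite-mono (<⇒<′ n<m)))

  -- Nothing lies strictly between `finite n` and its successor, so descending from `n` cannot skip
  -- `y`; it stops at the latest at the least element.
  finite-reaches : ∀ n {y} → ¬ finite n < y → ∃ λ m → finite m ≡ y
  finite-reaches n {y} n≮y with compare (finite n) y
  ... | tri< n<y _ _ = ⊥-elim (n≮y n<y)
  ... | tri≈ _ n≡y _ = n , n≡y
  finite-reaches zero {y} _ | tri> _ _ y<0 =
    ⊥-elim (proj₂ (proj₂ (least {P = λ _ → ⊤} (inhabitant , tt))) y y<0 tt)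
  finite-reaches (suc n) _ | tri> _ _ y<1+n =
    finite-reaches n λ n<y → <⇒≮next n<y y<1+n

  -- If some α lies above all finite ordinals, ℕ is a retract of `↓ α` and regularity applies to `x`
  -- composed with the retraction. Otherwise every element is finite and κ injects into ℕ.
  ω-bounded : (x : ℕ → Carrier) → ∃ λ β → ∀ n → x n < β
  ω-bounded x with em {∃ λ α → ∀ n → finite n < α}
  ... | yes (α , below) = proj₁ bound , λ n →
    subst (λ m → x m < proj₁ bound) (r-inverse n) (proj₂ bound (finite n , below n))
    where
    r-spec : ∃ λ (r : ↓ α → ℕ) → ∀ n → r (finite n , below n) ≡ n
    r-spec = retraction (λ n → finite n , below n) (finite-injective ∘ cong proj₁) 0

    r-inverse = proj₂ r-spec

    bound : ∃ λ β → ∀ i → x (proj₁ r-spec i) < β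
    bound = strict-bound α (x ∘ proj₁ r-spec)
  ... | no unbounded = ⊥-elim (uncountable (mk↣ {to = proj₁ ∘ index} λ {y} {y′} eq →
      trans (sym (proj₂ (index y))) (trans (cong finite eq) (proj₂ (index y′)))))
    where
    index : ∀ y → ∃ λ n → finite n ≡ y
    index y with counterexample (λ below → unbounded (y , below))
    ... | n , ≮y = finite-reaches n ≮y

  -- Clubs of closure points.

  infix 20 _closedUnder_
  -- `nonempty` rules out 0, which is vacuously closed, and supplies an argument at which `h` can be
  -- evaluated.
  record _closedUnder_ (ξ : Carrier) (h : Carrier → Carrier → Carrier) : Set where
    constructor _,_
    field
      nonempty : ∃ λ α → α < ξ
      closed   : ∀ {α β} → α < ξ → β < ξ → h α β < ξ

  open _closedUnder_

  -- At a limit of closure points, two arguments already lie below a common closure point. For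
  -- unboundedness, ω many steps are iterated, each passing all values of `h` at arguments below the
  -- previous stage; the supremum exists by `ω-bounded`.
  closure-points-club : ∀ h → Club κ (_closedUnder h)
  closure-points-club h = limit-closed , unbounded
    where
    limit-closed : Closed κ (_closedUnder h)
    limit-closed ξ (ne , limit) = ne , λ {α} {β} α<ξ β<ξ →
      let γ , γ-closed , α⊔β<γ , γ<ξ = limit (α ⊔ β) (⊔-lub-< α<ξ β<ξ)
      in <-trans (closed γ-closed (⊔<⇒<ˡ α⊔β<γ) (⊔<⇒<ʳ α⊔β<γ)) γ<ξ

    unbounded : Unbounded κ (_closedUnder h)
    unbounded γ = ξ , ((γ , x<ξ 0) , closed-ξ) , x<ξ 0
      where
      x : ℕ → Carrier
      x zero    = γ
      x (suc n) = next (x n ⊔ proj₁ (strict-bound₂ (x n) h))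

      x-grows : ∀ n → x n < x (suc n)
      x-grows n = ⊔<⇒<ˡ (<next _)

      h-grows : ∀ n {α β} → α < x n → β < x n → h α β < x (suc n)
      h-grows n α<x β<x =
        <-trans (proj₂ (strict-bound₂ (x n) h) _ _ α<x β<x) (⊔<⇒<ʳ (<next _))

      supremum : ∃ λ ξ → (∀ n → x n < ξ) × (∀ η → η < ξ → ¬ (∀ n → x n < η))
      supremum = least (ω-bounded x)

      ξ : Carrier
      ξ = proj₁ supremum

      x<ξ : ∀ n → x n < ξ
      x<ξ = proj₁ (proj₂ supremum)

      x-cofinal : ∀ {α} → α < ξ → ∃ λ n → α < x n
      x-cofinal {α} α<ξ with counterexample (proj₂ (proj₂ supremum) α α<ξ)
      ... | n , x≮α with compare α (x n)
      ...   | tri< α<x _ _  = n , α<x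
      -- The inequality must be strict, so equality moves on one stage.
      ...   | tri≈ _ refl _ = suc n , x-grows n
      ...   | tri> _ _ x<α  = ⊥-elim (x≮α x<α)

      closed-ξ : ∀ {α β} → α < ξ → β < ξ → h α β < ξ
      closed-ξ α<ξ β<ξ =
        let n , α⊔β<x = x-cofinal (⊔-lub-< α<ξ β<ξ)
        in <-trans (h-grows n (⊔<⇒<ˡ α⊔β<x) (⊔<⇒<ʳ α⊔β<x)) (x<ξ (suc n))

  -- The closure points of the pointwise maximum form the intersection of the two clubs of closure
  -- points.
  _⊔ᶠ_ : (f g : Carrier → Carrier → Carrier) → Carrier → Carrier → Carrier
  (f ⊔ᶠ g) α β = f α β ⊔ g α β

  closed-⊔ᶠ⁻ˡ : ∀ {ξ f g} → ξ closedUnder (f ⊔ᶠ g) → ξ closedUnder f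
  closed-⊔ᶠ⁻ˡ (ne , cl) = ne , λ α<ξ β<ξ → ⊔<⇒<ˡ (cl α<ξ β<ξ)

  closed-⊔ᶠ⁻ʳ : ∀ {ξ f g} → ξ closedUnder (f ⊔ᶠ g) → ξ closedUnder g
  closed-⊔ᶠ⁻ʳ (ne , cl) = ne , λ α<ξ β<ξ → ⊔<⇒<ʳ (cl α<ξ β<ξ)

  -- `k δ α` bounds `f α` on all arguments up to and including δ. Taking δ to be the maximum of the
  -- two arguments keeps δ below ξ.
  diagonal-closure : (f : Carrier → Carrier → Carrier → Carrier) →
    ∃ λ k → ∀ ξ → ξ closedUnder k → ∀ α → α < ξ → ξ closedUnder (f α)
  diagonal-closure f = (λ δ α → proj₁ (bound δ α)) , λ ξ (ne , cl) α α<ξ →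
    ne , λ {β} {γ} β<ξ γ<ξ → <-trans
      (proj₂ (bound (β ⊔ γ) α) β γ (⊔<⇒<ˡ (<next _)) (⊔<⇒<ʳ (<next _)))
      (cl (⊔-lub-< β<ξ γ<ξ) α<ξ)
    where
    bound : ∀ δ α → ∃ λ μ → ∀ β γ → β < next δ → γ < next δ → f α β γ < μ
    bound δ α = strict-bound₂ (next δ) (f α)

  -- Gödel pairing by recursion along a well-founded order.

  module StrictlyMonotone {A : Set} {_≺_ : Rel A 0ℓ} (≺-wf : WellFounded _≺_)
    (bound : ∀ q (h : A → Carrier) → ∃ λ δ → ∀ p → p ≺ q → h p < δ) where

    restrict : ∀ {q} → (∀ {p} → p ≺ q → Carrier) → ∀ p → Dec (p ≺ q) → Carrier
    restrict f p (yes p≺q) = f p≺q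
    -- An arbitrary default: `bound` is consulted only about `p ≺ q`.
    restrict f p (no _)    = inhabitant

    step : ∀ q → (∀ {p} → p ≺ q → Carrier) → Carrier
    step q f = proj₁ (bound q λ p → restrict f p em)

    step-cong : ∀ q {f g : ∀ {p} → p ≺ q → Carrier} →
      (∀ {p} p≺q → f {p} p≺q ≡ g p≺q) → step q f ≡ step q g
    step-cong q {f} {g} f≗g =
      cong (λ h → proj₁ (bound q h)) (ext λ p → restrict-cong p em)
      where
      restrict-cong : ∀ p (d : Dec (p ≺ q)) → restrict f p d ≡ restrict g p d
      restrict-cong p (yes p≺q) = f≗g p≺q
      restrict-cong p (no _)    = refl

    embed : A → Carrier
    embed = All.wfRec ≺-wf 0ℓ (λ _ → Carrier) step

    embed-mono : ∀ {p q} → p ≺ q → embed p < embed q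
    embed-mono {p} {q} p≺q =
      subst₂ _<_ (restrict-below em) (sym unfold) (proj₂ (bound q _) p p≺q)
      where
      unfold : embed q ≡ step q λ {p} _ → embed p
      unfold = FixPoint.unfold-wfRec ≺-wf (λ _ → Carrier) step step-cong

      restrict-below : (d : Dec (p ≺ q)) → restrict (λ {p} _ → embed p) p d ≡ embed p
      restrict-below (yes _)  = refl
      restrict-below (no p⊀q) = ⊥-elim (p⊀q p≺q)

    embed-injective : (∀ p q → p ≢ q → p ≺ q ⊎ q ≺ p) →
                      ∀ {p q} → embed p ≡ embed q → p ≡ q
    embed-injective total {p} {q} eq = dne λ p≢q → distinct (total p q p≢q)
      where
      distinct : ¬ (p ≺ q ⊎ q ≺ p)
      distinct (inj₁ p≺q) = irrefl eq (embed-mono p≺q)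
      distinct (inj₂ q≺p) = irrefl (sym eq) (embed-mono q≺p)

  -- Pairs are ordered as in Gödel's pairing, by a bound on both components
  -- first, so that every initial segment is bounded.
  rank : Carrier × Carrier → Carrier × (Carrier × Carrier)
  rank (α , β) = next (α ⊔ β) , (α , β)

  _<ₗₑₓ_ : Rel (Carrier × (Carrier × Carrier)) 0ℓ
  _<ₗₑₓ_ = ×-Lex _≡_ _<_ (×-Lex _≡_ _<_ _<_)

  _≺_ : Rel (Carrier × Carrier) 0ℓ
  _≺_ = _<ₗₑₓ_ on rank

  ≺-wellFounded : WellFounded _≺_
  ≺-wellFounded = On.wellFounded rank
    (×-wellFounded <-wellFounded (×-wellFounded <-wellFounded <-wellFounded))

  rank-bound : Carrier × Carrier → Carrier
  rank-bound = proj₁ ∘ rank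

  -- Here the `next` in `rank` matters: the two rank bounds may be equal, yet `α ⊔ β` still lies
  -- strictly below.
  ≺⇒<rank-bound : ∀ {α β q} → (α , β) ≺ q → (α < rank-bound q) × (β < rank-bound q)
  ≺⇒<rank-bound {α} {β} {q} p≺q = ⊔<⇒<ˡ (below p≺q) , ⊔<⇒<ʳ (below p≺q)
    where
    below : (α , β) ≺ q → α ⊔ β < rank-bound q
    below (inj₁ lt)       = <-trans (<next _) lt
    below (inj₂ (eq , _)) = subst (α ⊔ β <_) eq (<next _)

  ≺-bound : ∀ q (h : Carrier × Carrier → Carrier) → ∃ λ δ → ∀ p → p ≺ q → h p < δ
  ≺-bound q h =
    let δ , h<δ = strict-bound₂ (rank-bound q) λ α β → h (α , β)
    in δ , λ (α , β) p≺q → uncurry (h<δ α β) (≺⇒<rank-bound p≺q)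

  ≺-cases : ∀ p q → p ≢ q → p ≺ q ⊎ q ≺ p
  ≺-cases p q p≢q
    with ×-compare sym compare (×-compare sym compare compare) (rank p) (rank q)
  ... | tri< p≺q _ _           = inj₁ p≺q
  ... | tri≈ _ (_ , α≡ , β≡) _ = ⊥-elim (p≢q (cong₂ _,_ α≡ β≡))
  ... | tri> _ _ q≺p           = inj₂ q≺p

  -- Opaque, because unfolding the well-founded recursion is expensive.
  opaque
    pair : Carrier × Carrier → Carrier
    pair = StrictlyMonotone.embed ≺-wellFounded ≺-bound

    pair-injective : ∀ {p q} → pair p ≡ pair q → p ≡ q
    pair-injective = StrictlyMonotone.embed-injective ≺-wellFounded ≺-bound ≺-cases

  unpair : Carrier → Carrier × Carrier
  unpair = proj₁ (retraction pair pair-injective (inhabitant , inhabitant))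

  unpair-pair : ∀ p → unpair (pair p) ≡ p
  unpair-pair = proj₂ (retraction pair pair-injective (inhabitant , inhabitant))

  -- Coding triples and guessing relations.

  bit : Bool → Carrier
  bit true  = inhabitant
  bit false = next inhabitant

  bit-injective : ∀ {b c} → bit b ≡ bit c → b ≡ c
  bit-injective {true}  {true}  _  = refl
  bit-injective {true}  {false} eq = ⊥-elim (irrefl eq (<next _))
  bit-injective {false} {true}  eq = ⊥-elim (irrefl (sym eq) (<next _))
  bit-injective {false} {false} _  = refl

  code : Carrier × Carrier × Bool → Carrier
  code (α , β , b) = pair (pair (α , β) , bit b)

  code-injective : ∀ {x y} → code x ≡ code y → x ≡ y
  code-injective eq = cong₂ (λ (α , β) b → α , β , b)
    (pair-injective (cong proj₁ (pair-injective eq)))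
    (bit-injective (cong proj₂ (pair-injective eq)))

  decoding : ∃ λ (r : Carrier → Carrier × Carrier × Bool) → ∀ x → r (code x) ≡ x
  decoding = retraction code code-injective (inhabitant , inhabitant , true)

  decode : Carrier → Carrier × Carrier × Bool
  decode = proj₁ decoding

  decode-code : ∀ x → decode (code x) ≡ x
  decode-code = proj₂ decoding

  -- The set of codes of `R` is guessed at some ξ closed under `h` and under `code-bound`. The
  -- latter puts the codes of all triples over ξ below ξ, where the guess is correct.
  ◇-guesses-relations : ◇ κ →
    ∃ λ (g : Carrier → Carrier → Carrier → Bool → Set) →
      ∀ (R : Carrier → Carrier → Bool → Set) h →
      ∃ λ ξ → ξ closedUnder h ×
        (∀ α β b → α < ξ → β < ξ → g ξ α β b ⇔ R α β b)
  ◇-guesses-relations (d , d-guesses) = g , guessed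
    where
    g : Carrier → Carrier → Carrier → Bool → Set
    g ξ α β b = κ-List._at_ d ξ (code (α , β , b))

    code-bound : Carrier → Carrier → Carrier
    code-bound α β = code (α , β , true) ⊔ code (α , β , false)

    code<code-bound : ∀ {α β ξ} b → code-bound α β < ξ → code (α , β , b) < ξ
    code<code-bound true  = ⊔<⇒<ˡ
    code<code-bound false = ⊔<⇒<ʳ

    module _ (R : Carrier → Carrier → Bool → Set) where
      holds : Carrier × Carrier × Bool → Set
      holds (α , β , b) = R α β b

      agrees : ∀ {ξ} → guesses κ d (holds ∘ decode) ξ → ξ closedUnder code-bound →
               ∀ α β b → α < ξ → β < ξ → g ξ α β b ⇔ R α β b
      agrees (d⊆R , R⊆d) cl α β b α<ξ β<ξ = mk⇔
        (λ dx → subst holds (decode-code (α , β , b)) (proj₁ (d⊆R dx)))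
        (λ r → R⊆d ( subst holds (sym (decode-code (α , β , b))) r
                    , code<code-bound b (closed cl α<ξ β<ξ)))

      guessed : ∀ h → ∃ λ ξ → ξ closedUnder h ×
        (∀ α β b → α < ξ → β < ξ → g ξ α β b ⇔ R α β b)
      guessed h =
        let ξ , d≐R , cl = d-guesses (holds ∘ decode) (_closedUnder (h ⊔ᶠ code-bound))
                             (closure-points-club (h ⊔ᶠ code-bound))
        in ξ , closed-⊔ᶠ⁻ˡ cl , agrees d≐R (closed-⊔ᶠ⁻ʳ {f = h} cl)

  -- The normal uniform filter generated by a family.

  module GeneratedFilter {I : Set} (i₀ : I) (G : I → Subset κ) where

    -- Membership must be a small type, so clubs enter through the functions h
    -- whose closure points they contain, and not as subsets of κ.
    Generated : Pred (Subset κ) 0ℓ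
    Generated X = ∃ λ (s : Carrier → I) → ∃ λ h →
      ∀ ξ → ξ closedUnder h → Δ κ (G ∘ s) ξ → X ξ

    generator∈ : ∀ i → G i ∈ Generated
    -- Every nonzero ξ is closed under the first projection.
    generator∈ i = const i , (λ α _ → α) , λ ξ ((α , α<ξ) , _) GΔ → GΔ α α<ξ

    cobounded∈ : ∀ X → Cobounded κ X → X ∈ Generated
    -- The closure points of the constant function γ are exactly the ξ above γ.
    cobounded∈ X (γ , ∁X<γ) = const i₀ , (λ _ _ → γ) , λ ξ ((α , α<ξ) , cl) _ →
      dne λ ξ∉X → asym (∁X<γ ξ∉X) (cl α<ξ α<ξ)

    -- The κ many sequences of indices witnessing `X∈` are flattened into one along `pair`. A ξ
    -- closed under `pair` meets every entry with both coordinates below ξ, and `diagonal-closure`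
    -- merges the witnessing functions.
    Δ∩closed⊆⇒∈ : ∀ {X Y} h → (∀ α → X α ∈ Generated) →
      (∀ ξ → ξ closedUnder h → Δ κ X ξ → Y ξ) → Y ∈ Generated
    Δ∩closed⊆⇒∈ {X} {Y} h X∈ Δ⊆Y = s , (h ⊔ᶠ k) ⊔ᶠ pair′ , λ ξ cl GΔ →
      let cl′ = closed-⊔ᶠ⁻ˡ {g = pair′} cl in
      Δ⊆Y ξ (closed-⊔ᶠ⁻ˡ {g = k} cl′) λ α α<ξ →
        proj₂ (proj₂ (X∈ α)) ξ (k-closed ξ (closed-⊔ᶠ⁻ʳ {f = h} cl′) α α<ξ) λ β β<ξ →
          subst (λ (α , β) → G (proj₁ (X∈ α) β) ξ) (unpair-pair (α , β))
            (GΔ (pair (α , β)) (closed (closed-⊔ᶠ⁻ʳ {f = h ⊔ᶠ k} cl) α<ξ β<ξ))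
      where
      s : Carrier → I
      s x = let α , β = unpair x in proj₁ (X∈ α) β

      pair′ : Carrier → Carrier → Carrier
      pair′ α β = pair (α , β)

      diagonal = diagonal-closure λ α → proj₁ (proj₂ (X∈ α))
      k = proj₁ diagonal
      k-closed = proj₂ diagonal

    isFilter : IsFilter κ Generated
    isFilter = record
      { U-mem    = const i₀ , (λ α _ → α) , λ _ _ _ → _
      -- A binary intersection is a diagonal one: `X` sits at index `inhabitant` and `Y` at all
      -- others. The constant function puts both `inhabitant` and its successor below ξ.
      ; ∩-closed = λ {X} {Y} X∈ Y∈ → Δ∩closed⊆⇒∈ {either X Y} (λ _ _ → next inhabitant)
          (λ α → either-∈ X∈ Y∈ (does (em {α ≡ inhabitant})))
          λ ξ ((α , α<ξ) , cl) XYΔ →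
            let 1<ξ = cl α<ξ α<ξ in
            subst (λ b → (if b then X else Y) ξ) (dec-true em refl)
              (XYΔ inhabitant (<-trans (<next _) 1<ξ)) ,
            subst (λ b → (if b then X else Y) ξ)
              (dec-false em λ eq → irrefl (sym eq) (<next _)) (XYΔ (next inhabitant) 1<ξ)
      ; ⊆-closed = λ (s , h , ⊆X) X⊆Y → s , h , λ ξ cl GΔ → X⊆Y (⊆X ξ cl GΔ)
      }
      where
      either : Subset κ → Subset κ → Carrier → Subset κ
      either X Y α = if does (em {α ≡ inhabitant}) then X else Y

      either-∈ : ∀ {X Y} → X ∈ Generated → Y ∈ Generated →
                 ∀ b → (if b then X else Y) ∈ Generated
      either-∈ X∈ Y∈ true  = X∈
      either-∈ X∈ Y∈ false = Y∈

    isProperNormalUniformFilter :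
      (∀ s h → ∃ λ ξ → ξ closedUnder h × Δ κ (G ∘ s) ξ) →
      IsProperNormalUniformFilter κ Generated
    isProperNormalUniformFilter stationary = record
      { isFilter = isFilter
      ; proper   = λ (s , h , ⊆∅) →
          let ξ , cl , GΔ = stationary s h in ⊆∅ ξ cl GΔ
      ; normal   = λ X X∈ → Δ∩closed⊆⇒∈ (λ α _ → α) X∈ λ _ _ XΔ → XΔ
      ; uniform  = cobounded∈
      }

  -- From ◇ to a ◇-tree.

  ◇⇒DiamondTree : ◇ κ → DiamondTree κ
  ◇⇒DiamondTree diamond = D , λ a →
    let open GeneratedFilter (const true) (S a) in
    Generated , isProperNormalUniformFilter (S-stationary a) , generator∈
    where
    g = proj₁ (◇-guesses-relations diamond)

    -- Row α of the relation guessed at ξ codes a branch by its `true` bits and a subset by its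
    -- `false` bits.
    D : Node κ → Subset κ
    D (ξ , t) η = η < ξ × ∃ λ α → α < ξ ×
      (∀ β (β<ξ : β < ξ) → g ξ α β true ⇔ (t (β , β<ξ) ≡ true)) × g ξ α η false

    S : (Branch κ → Subset κ) → Branch κ → Subset κ
    S a s ξ = D (_↾_ κ s ξ) ≐ (a s ∩ segment ξ)

    S-stationary : ∀ a (s : Carrier → Branch κ) h →
      ∃ λ ξ → ξ closedUnder h × Δ κ (S a ∘ s) ξ
    S-stationary a s h = ξ , closed-⊔ᶠ⁻ˡ cl , λ α α<ξ → D⊆a α α<ξ , a⊆D α α<ξ
      where
      R : Carrier → Carrier → Bool → Set
      R α β true  = s α β ≡ true
      R α β false = a (s α) β

      -- One point decides equality of two branches: a point of difference if there is one, any
      -- default otherwise.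
      differing : ∀ α α′ → ∃ λ δ → s α δ ≡ s α′ δ → s α ≡ s α′
      differing α α′ with em {∃ λ δ → s α δ ≢ s α′ δ}
      ... | yes (δ , ≢) = δ , λ eq → ⊥-elim (≢ eq)
      ... | no none     = α , λ _ → ext λ β → dne λ ≢ → none (β , ≢)

      difference : Carrier → Carrier → Carrier
      difference α α′ = proj₁ (differing α α′)

      guessed = proj₂ (◇-guesses-relations diamond) R (h ⊔ᶠ difference)
      ξ = proj₁ guessed
      cl = proj₁ (proj₂ guessed)
      g⇔R = proj₂ (proj₂ guessed)

      true-determines : ∀ {b c} → (b ≡ true ⇔ c ≡ true) → b ≡ c
      true-determines {true}  {c}     iff = sym (Equivalence.to iff refl)
      true-determines {false} {false} iff = refl
      true-determines {false} {true}  iff = Equivalence.from iff refl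

      D⊆a : ∀ α → α < ξ → ∀ {η} → D (_↾_ κ (s α) ξ) η → (a (s α) ∩ segment ξ) η
      D⊆a α α<ξ {η} (η<ξ , α′ , α′<ξ , same , guess) =
        subst (λ b → a b η) sα′≡sα (Equivalence.to (g⇔R α′ η false α′<ξ η<ξ) guess) , η<ξ
        where
        δ<ξ : difference α′ α < ξ
        δ<ξ = closed (closed-⊔ᶠ⁻ʳ {f = h} cl) α′<ξ α<ξ

        sα′≡sα : s α′ ≡ s α
        -- At the deciding point, which lies below ξ, row α′ of the guess agrees with `s α′` because
        -- the guess is correct, and with `s α` by `same`.
        sα′≡sα = proj₂ (differing α′ α) (true-determines (mk⇔
          (λ t → Equivalence.to (same _ δ<ξ) (Equivalence.from (g⇔R α′ _ true α′<ξ δ<ξ) t))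
          (λ t → Equivalence.to (g⇔R α′ _ true α′<ξ δ<ξ) (Equivalence.from (same _ δ<ξ) t))))

      a⊆D : ∀ α → α < ξ → ∀ {η} → (a (s α) ∩ segment ξ) η → D (_↾_ κ (s α) ξ) η
      a⊆D α α<ξ {η} (η∈a , η<ξ) =
        η<ξ , α , α<ξ , (λ β β<ξ → g⇔R α β true α<ξ β<ξ) ,
        Equivalence.from (g⇔R α η false α<ξ η<ξ) η∈a

  -- From a ◇-tree back to ◇.

  DiamondTree⇒JointDiamond : DiamondTree κ → JointDiamond κ (Branch κ)
  DiamondTree⇒JointDiamond (D , tree) = d , λ a →
    let F , isF , S∈F = tree a in
    F , isF , λ s → IsFilter.⊆-closed (IsProperNormalUniformFilter.isFilter isF) (S∈F s)
      λ (D⊆a , a⊆D) → (λ (x , _) → D⊆a x) , λ (x , x<ξ) → a⊆D (x , x<ξ) , x<ξ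
    where
    d : Branch κ → κ-List κ
    -- Values of `D` may exceed the level; truncating them changes nothing where the guess is
    -- correct.
    d s = record { _at_ = λ ξ → D (_↾_ κ s ξ) ∩ segment ξ ; bounded = λ _ → proj₂ }

  -- A family `a` over `Λ′` is spread over `Λ` as `a ∘ r`, which returns `a x` at index `i x`.
  JointDiamond-retract : ∀ {Λ Λ′ : Set} (i : Λ′ → Λ) (r : Λ → Λ′) →
    (∀ x → r (i x) ≡ x) → JointDiamond κ Λ → JointDiamond κ Λ′
  JointDiamond-retract i r r∘i (d , joint) = d ∘ i , λ a →
    let F , isF , guess∈F = joint (a ∘ r) in
    F , isF , λ x → IsFilter.⊆-closed (IsProperNormalUniformFilter.isFilter isF)
      (guess∈F (i x)) λ {ξ} → subst (λ y → guesses κ (d (i x)) (a y) ξ) (r∘i x)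

  -- Let `above α` be an element of `C` beyond α. A nonzero ξ in the diagonal intersection of the
  -- tails past `above α` is a limit point of `C`. The tail past `inhabitant` excludes 0.
  club∈normal-uniform-filter : ∀ {F} → IsProperNormalUniformFilter κ F →
                               ∀ {C} → Club κ C → C ∈ F
  club∈normal-uniform-filter {F} isF {C} (closed , unbounded) =
    ⊆-closed (∩-closed (tail∈F inhabitant) (normal _ λ α → tail∈F (above α)))
      λ {ξ} (0<ξ , above<ξ) → closed ξ ((inhabitant , 0<ξ) , λ α α<ξ →
        above α , proj₁ (proj₂ (unbounded α)) , proj₂ (proj₂ (unbounded α)) , above<ξ α α<ξ)
    where
    open IsProperNormalUniformFilter isF
    open IsFilter isFilter

    above : Carrier → Carrier
    above α = proj₁ (unbounded α)

    tail∈F : ∀ γ → (γ <_) ∈ F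
    tail∈F γ = uniform _ (next γ , ≮⇒<next)

  JointDiamond⇒◇ : ∀ {Λ} → Λ → JointDiamond κ Λ → ◇ κ
  JointDiamond⇒◇ i (d , joint) = d i , λ a C club → dne λ empty →
    let F , isF , guess∈F = joint (const a)
        open IsProperNormalUniformFilter isF
        open IsFilter isFilter
    in proper (⊆-closed (∩-closed (guess∈F i) (club∈normal-uniform-filter isF club))
         λ {ξ} x → empty (ξ , x))

  -- These characteristic functions embed κ into its power set, which cuts length 2^κ down to κ.
  singleton : Carrier → Branch κ
  singleton α β = does (em {α ≡ β})

  singleton-injective : ∀ {α β} → singleton α ≡ singleton β → α ≡ β
  singleton-injective {α} {β} eq with em {α ≡ β} | cong (λ s → s β) eq
  ... | yes α≡β | _   = α≡β
  ... | no _    | eq′ with trans eq′ (dec-true (em {β ≡ β}) refl)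
  ...   | ()

theorem5p8 : ExcludedMiddle 0ℓ →
    Extensionality 0ℓ 0ℓ →
    (κ : Ordinal) → UncountableRegularCardinal κ →
    (2^κ : Set) → 2^κ ⤖ Branch κ →
    (◇ κ ⇔ JointDiamond κ (Ordinal.Carrier κ))
    × (JointDiamond κ (Ordinal.Carrier κ) ⇔ JointDiamond κ 2^κ)
    × (JointDiamond κ 2^κ ⇔ DiamondTree κ)
theorem5p8 em ext κ urc 2^κ 2^κ⤖Branch =
    mk⇔ (shorten ∘ tree⇒2^κ ∘ ◇⇒DiamondTree) κ⇒◇
  , mk⇔ (tree⇒2^κ ∘ ◇⇒DiamondTree ∘ κ⇒◇) shorten
  , mk⇔ (◇⇒DiamondTree ∘ κ⇒◇ ∘ shorten) tree⇒2^κ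
  where
  open RegularCardinal em ext κ urc
  open Inverse (⤖⇒↔ 2^κ⤖Branch) using (to; from; strictlyInverseˡ; strictlyInverseʳ)

  tree⇒2^κ : DiamondTree κ → JointDiamond κ 2^κ
  tree⇒2^κ = JointDiamond-retract to from strictlyInverseʳ ∘ DiamondTree⇒JointDiamond

  κ⇒◇ : JointDiamond κ (Ordinal.Carrier κ) → ◇ κ
  κ⇒◇ = JointDiamond⇒◇ inhabitant

  shorten : JointDiamond κ 2^κ → JointDiamond κ (Ordinal.Carrier κ)
  shorten = uncurry (JointDiamond-retract (from ∘ singleton)) (Classical.retraction em
    (from ∘ singleton)
    (λ {α} {β} eq → singleton-injective
      (trans (sym (strictlyInverseˡ (singleton α)))
             (trans (cong to eq) (strictlyInverseˡ (singleton β)))))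
    inhabitant)
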